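{- There exists an absolute constant $c>0$ such that, for all sufficiently large integers $l$, \[ r_3(l,l,l) \geq 2^{\,l^{\,c \log \log l}}. \]
   Context: For a positive integer $l$, the $3$-colour $3$-uniform hypergraph Ramsey number $r_3(l,l,l)$ is the smallest positive integer $N$ such that for every colouring of the $3$-element subsets of an $N$-element set with three colours, there exist a colour and an $l$-element subset $S$ all of whose $3$-element subsets receive that colour (i.e. a monochromatic copy of the complete $3$-uniform hypergraph $K_l^{(3)}$). Here $\log$ denotes the logarithm to base $2$. -}

module Defs where

open import Data.Nat using (ℕ; _<_)
open import Data.Fin using (Fin) renaming (_<_ to _<ᶠ_)
open import Data.Product using (Σ; _×_)
open import Relation.Binary.PropositionalEquality using (_≡_)
open import Relation.Nullary using (¬_)

-- A 3-colouring of the 3-element subsets of an N-element set {0,…,N-1}.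
-- A 3-subset {i,j,k} with i < j < k receives the colour χ i j k; values of
-- χ on non-increasing triples are irrelevant (never inspected).
Colouring3 : ℕ → Set
Colouring3 N = Fin N → Fin N → Fin N → Fin 3

-- An l-element subset of Fin N, given by its strictly increasing enumeration.
StrictlyIncreasing : {l N : ℕ} → (Fin l → Fin N) → Set
StrictlyIncreasing {l} f = ∀ (a b : Fin l) → a <ᶠ b → f a <ᶠ f b

Monochromatic : {l N : ℕ} → Colouring3 N → (Fin l → Fin N) → Fin 3 → Set
Monochromatic {l} χ f c =
  ∀ (a b d : Fin l) → a <ᶠ b → b <ᶠ d → χ (f a) (f b) (f d) ≡ c

-- There is a 3-colouring of the 3-subsets of an N-set with no monochromatic K_l^(3).
-- By definition of r₃ (and downward closure), this says exactly  N < r₃(l,l,l).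
Avoids : ℕ → ℕ → Set
Avoids N l = Σ (Colouring3 N) λ χ →
  ∀ (f : Fin l → Fin N) → StrictlyIncreasing f → ∀ (c : Fin 3) → ¬ Monochromatic χ f c

{-# OPTIONS --safe #-}

-- Step up from a graph on the m levels of the binary tree {0,1}^m.  A sorted triple x < y < z
-- determines the levels i ≠ j at which x, y and y, z split: it gets colour 0 if ij is an edge,
-- and otherwise colour 1 or 2 according to whether the upper split is the right one or the left
-- one.  In a set of colour 0 the branching levels along each path of its trie form a clique, so
-- at most 2^ω points occur, ω being the clique number; in a set of colour 1 or 2 the trie is a
-- comb, and its branching levels form an independent set of one element less.  So it suffices
-- that the graph has no clique of size s with 2^s ≤ l and no independent set of size l - 1.
-- The union bound for the random graph with edge probability 1/(1 + 2^u), u = ⌊log log l⌋,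
-- provides one on m < l^(c log log l) vertices.
module Submission where

open import Defs
open import Data.Nat using (ℕ; suc; _<_; _≤_; _^_)
open import Data.Nat.Logarithm using (⌊log₂_⌋)
open import Data.Product using (Σ)

open import Data.Bool.Base using (Bool; true; false; if_then_else_)
open import Data.Fin.Base as Fin using (Fin; toℕ; combine; remQuot)
open import Data.Fin.Patterns using (0F; 1F; 2F)
import Data.Fin.Properties as Fin
open import Data.Fin.Subset using (Subset; ∣_∣)
open import Data.List.Base using (List; []; _∷_; length; tabulate)
open import Data.List.Membership.Propositional using (_∈_)
open import Data.List.Membership.Propositional.Properties using (∈-tabulate⁻)
open import Data.List.Properties using (length-tabulate)
open import Data.List.Relation.Unary.All as All using (All; []; _∷_)
open import Data.List.Relation.Unary.AllPairs using ([]; _∷_)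
open import Data.List.Relation.Unary.Any using (here; there)
open import Data.List.Relation.Unary.Unique.Propositional using (Unique)
open import Data.List.Relation.Unary.Unique.Propositional.Properties using (tabulate⁺)
open import Data.Nat hiding (ℕ; suc; _<_; _≤_; _^_; compare)
open import Data.Nat.DivMod using (m≡m%n+[m/n]*n; m%n<n; m/n*n≤m; /-monoˡ-≤)
open import Data.Nat.Induction using (<-rec)
open import Data.Nat.Logarithm using (⌊log₂⌋-mono-≤; ⌊log₂⌊n/2⌋⌋≡⌊log₂n⌋∸1; ⌊log₂[2^n]⌋≡n)
open import Data.Nat.Properties
open import Data.Nat.Tactic.RingSolver using (solve-∀)
open import Data.Product.Base using (∃; _×_; _,_; proj₁; proj₂; uncurry)
open import Data.Sum.Base using (_⊎_; inj₁; inj₂)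
open import Data.Unit.Base using (⊤; tt)
open import Data.Vec.Base using (Vec; []; _∷_)
open import Function.Base using (_∘_)
open import Relation.Binary.Definitions using (tri<; tri≈; tri>)
open import Relation.Binary.PropositionalEquality
open import Relation.Nullary.Decidable using (yes; no)
open import Relation.Nullary.Negation using (¬_; contradiction)

-- Arithmetic

-- The binomial coefficient `n` choose 2, in the form in which cliques are built below: a new vertex
-- adds `n` edges.
triangle : ℕ → ℕ
triangle zero    = 0
triangle (suc n) = n + triangle n

-- Counts the pairs between disjoint sets of sizes `a` and `b`; at `a = b` it bounds `triangle`
-- below by a square without any division.
*≤triangle : ∀ a b → a * b ≤ triangle (a + b)
*≤triangle zero    b = z≤n
*≤triangle (suc a) b = +-mono-≤ (m≤n+m b a) (*≤triangle a b)

n<2^n : ∀ n → n < 2 ^ n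
n<2^n zero    = s≤s z≤n
n<2^n (suc n) = begin
  2 + n         ≤⟨ +-mono-≤ (m^n>0 2 n) (n<2^n n) ⟩
  2 ^ n + 2 ^ n ≡⟨ cong (2 ^ n +_) (+-identityʳ (2 ^ n)) ⟨
  2 * 2 ^ n     ∎
  where open ≤-Reasoning

2^⌊log₂⌋≤ : ∀ n → 0 < n → 2 ^ ⌊log₂ n ⌋ ≤ n
2^⌊log₂⌋≤ = <-rec _ λ where
    zero          rec ()
    (suc zero)    rec _ → s≤s z≤n
    n@(suc (suc k)) rec _ → begin
      2 ^ ⌊log₂ n ⌋                   ≡⟨ cong (2 ^_) (suc-pred ⌊log₂ n ⌋ {{>-nonZero (⌊log₂⌋-mono-≤ {2} {n} (s≤s (s≤s z≤n)))}}) ⟨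
      2 * 2 ^ pred ⌊log₂ n ⌋          ≡⟨ cong (λ e → 2 * 2 ^ e) (sym (⌊log₂⌊n/2⌋⌋≡⌊log₂n⌋∸1 n)) ⟩
      2 * 2 ^ ⌊log₂ ⌊ n /2⌋ ⌋         ≤⟨ *-monoʳ-≤ 2 (rec (⌊n/2⌋<n (suc k)) (s≤s z≤n)) ⟩
      2 * ⌊ n /2⌋                     ≡⟨ cong (⌊ n /2⌋ +_) (+-identityʳ ⌊ n /2⌋) ⟩
      ⌊ n /2⌋ + ⌊ n /2⌋               ≤⟨ +-monoʳ-≤ ⌊ n /2⌋ (⌊n/2⌋≤⌈n/2⌉ n) ⟩
      ⌊ n /2⌋ + ⌈ n /2⌉               ≡⟨ ⌊n/2⌋+⌈n/2⌉≡n n ⟩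
      n                               ∎
  where open ≤-Reasoning

<2^1+⌊log₂⌋ : ∀ n → n < 2 ^ suc ⌊log₂ n ⌋
<2^1+⌊log₂⌋ n = ≰⇒> λ 2^≤n → 1+n≰n
  (subst (_≤ ⌊log₂ n ⌋) (⌊log₂[2^n]⌋≡n (suc ⌊log₂ n ⌋)) (⌊log₂⌋-mono-≤ 2^≤n))

≤⌊log₂⌋ : ∀ {k n} → 2 ^ k ≤ n → k ≤ ⌊log₂ n ⌋
≤⌊log₂⌋ {k} {n} 2^k≤n = subst (_≤ ⌊log₂ n ⌋) (⌊log₂[2^n]⌋≡n k) (⌊log₂⌋-mono-≤ 2^k≤n)

^-cancelˡ-< : ∀ n {a b} → a ^ n < b ^ n → a < b
^-cancelˡ-< n lt = ≰⇒> λ b≤a → <⇒≱ lt (^-monoˡ-≤ n b≤a)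

[1+n]³≤2n³ : ∀ n → 7 ≤ n → suc n * suc n * suc n ≤ 2 * (n * n * n)
[1+n]³≤2n³ n@(suc k) 7≤n = begin
  -- The added polynomial is the slack in `3n² + 3n + 1 ≤ 7n²` at `n = 1 + k`.
  suc n * suc n * suc n                         ≤⟨ m≤m+n _ (4 * (k * k) + 5 * k) ⟩
  suc n * suc n * suc n + (4 * (k * k) + 5 * k) ≡⟨ expand k ⟩
  n * n * n + n * n * 7                         ≤⟨ +-monoʳ-≤ (n * n * n) (*-monoʳ-≤ (n * n) 7≤n) ⟩
  n * n * n + n * n * n                         ≡⟨ cong (n * n * n +_) (+-identityʳ (n * n * n)) ⟨
  2 * (n * n * n)                               ∎
  where
  open ≤-Reasoning
  expand : ∀ k → (2 + k) * (2 + k) * (2 + k) + (4 * (k * k) + 5 * k)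
           ≡ (1 + k) * (1 + k) * (1 + k) + (1 + k) * (1 + k) * 7
  expand = solve-∀

n³<2^n : ∀ {n} → 16 ≤′ n → n * n * n < 2 ^ n
n³<2^n (≤′-reflexive refl)  = <ᵇ⇒< (16 * 16 * 16) (2 ^ 16) _
n³<2^n (≤′-step {n} 16≤′n) = begin-strict
  suc n * suc n * suc n  ≤⟨ [1+n]³≤2n³ n (≤-trans (m≤m+n 7 9) (≤′⇒≤ 16≤′n)) ⟩
  2 * (n * n * n)        <⟨ *-monoʳ-< 2 (n³<2^n 16≤′n) ⟩
  2 * 2 ^ n              ∎
  where open ≤-Reasoning

-- Bernoulli's inequality for (1 + 1/k)ʲ, cleared of denominators.
bernoulli : ∀ k j → j * k ^ j + k * k ^ j ≤ k * suc k ^ j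
bernoulli k zero = ≤-refl
bernoulli k (suc j) = begin
  suc j * (k * k ^ j) + k * (k * k ^ j)                    ≤⟨ m≤m+n _ (j * k ^ j) ⟩
  suc j * (k * k ^ j) + k * (k * k ^ j) + j * k ^ j        ≡⟨ rearrange j k (k ^ j) ⟩
  suc k * (j * k ^ j + k * k ^ j)                          ≤⟨ *-monoʳ-≤ (suc k) (bernoulli k j) ⟩
  suc k * (k * suc k ^ j)                                  ≡⟨ swap (suc k) k (suc k ^ j) ⟩
  k * (suc k * suc k ^ j)                                  ∎
  where
  open ≤-Reasoning
  rearrange : ∀ j k p → suc j * (k * p) + k * (k * p) + j * p ≡ suc k * (j * p + k * p)
  rearrange = solve-∀
  swap : ∀ a b c → a * (b * c) ≡ b * (a * c)
  swap = solve-∀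

-- Bernoulli at `j = k`: `(1 + 1/k)^k ≥ 2`.
2*k^k≤[1+k]^k : ∀ k .{{_ : NonZero k}} → 2 * k ^ k ≤ suc k ^ k
2*k^k≤[1+k]^k k = *-cancelˡ-≤ k (begin
  k * (2 * k ^ k)         ≡⟨ double k (k ^ k) ⟩
  k * k ^ k + k * k ^ k   ≤⟨ bernoulli k k ⟩
  k * suc k ^ k           ∎)
  where
  open ≤-Reasoning
  double : ∀ k p → k * (2 * p) ≡ k * p + k * p
  double = solve-∀

^-distribʳ-* : ∀ n a b → (a * b) ^ n ≡ a ^ n * b ^ n
^-distribʳ-* zero a b = refl
^-distribʳ-* (suc n) a b = trans (cong (a * b *_) (^-distribʳ-* n a b)) (swap a b (a ^ n) (b ^ n))
  where
  swap : ∀ a b c d → a * b * (c * d) ≡ a * c * (b * d)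
  swap = solve-∀

-- Each of `j` blocks of `k` factors gains a factor 2, and the remaining `d` factors only grow. So
-- `e` given pairs are all non-edges with probability at most `1 / 2 ^ j`.
2^j*k^e≤[1+k]^e : ∀ k .{{_ : NonZero k}} j {e} → k * j ≤ e → 2 ^ j * k ^ e ≤ suc k ^ e
2^j*k^e≤[1+k]^e k j kj≤e with d , refl ← m≤n⇒∃[o]m+o≡n kj≤e = begin
  2 ^ j * k ^ (k * j + d)                 ≡⟨ cong (2 ^ j *_) (^-distribˡ-+-* k (k * j) d) ⟩
  2 ^ j * (k ^ (k * j) * k ^ d)           ≡⟨ *-assoc (2 ^ j) _ _ ⟨
  2 ^ j * k ^ (k * j) * k ^ d             ≡⟨ cong (λ p → 2 ^ j * p * k ^ d) (^-*-assoc k k j) ⟨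
  2 ^ j * (k ^ k) ^ j * k ^ d             ≡⟨ cong (_* k ^ d) (^-distribʳ-* j 2 (k ^ k)) ⟨
  (2 * k ^ k) ^ j * k ^ d                 ≤⟨ *-mono-≤ (^-monoˡ-≤ j (2*k^k≤[1+k]^k k)) (^-monoˡ-≤ d (n≤1+n k)) ⟩
  (suc k ^ k) ^ j * suc k ^ d             ≡⟨ cong (_* suc k ^ d) (^-*-assoc (suc k) k j) ⟩
  suc k ^ (k * j) * suc k ^ d             ≡⟨ ^-distribˡ-+-* (suc k) (k * j) d ⟨
  suc k ^ (k * j + d)                     ∎
  where open ≤-Reasoning

-- The edge probability is 1/(1 + k); on fewer than 2^(nu) vertices, s bounds the cliques and t the
-- independent sets.  The size of a ensures k (2 + nut) ≤ a² ≤ triangle t.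
module Parameters (n u : ℕ) .{{_ : NonZero n}} .{{_ : NonZero u}} where
  open ≤-Reasoning
  k a s t : ℕ
  k = 2 ^ u
  a = 4 * n * u * k
  s = 4 * n + 4 * n
  t = a + a

  -- Union bound over at most `m ^ s` sets, each a clique with probability `1 / suc k ^ triangle s`;
  -- the factor 2 leaves room for the independent sets.
  trueBound : ∀ {m} → m < 2 ^ (n * u) → 2 * m ^ s < suc k ^ triangle s
  trueBound {m} m< = begin-strict
    2 * m ^ s                         ≤⟨ *-monoʳ-≤ 2 (^-monoˡ-≤ s (<⇒≤ m<)) ⟩
    2 * (2 ^ (n * u)) ^ s             ≡⟨ cong (2 *_) (^-*-assoc 2 (n * u) s) ⟩
    2 ^ (1 + n * u * s)               <⟨ ^-monoʳ-< 2 (s≤s (s≤s z≤n)) exponent ⟩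
    2 ^ (u * (4 * n * (4 * n)))       ≤⟨ ^-monoʳ-≤ 2 (*-monoʳ-≤ u (*≤triangle (4 * n) (4 * n))) ⟩
    2 ^ (u * triangle s)              ≡⟨ ^-*-assoc 2 u (triangle s) ⟨
    k ^ triangle s                    ≤⟨ ^-monoˡ-≤ (triangle s) (n≤1+n k) ⟩
    suc k ^ triangle s                ∎
    where
    pos : 1 ≤ n * n * u
    pos = *-mono-≤ (*-mono-≤ (>-nonZero⁻¹ n) (>-nonZero⁻¹ n)) (>-nonZero⁻¹ u)
    expand : ∀ n u → n * n * u * 8 + n * u * (4 * n + 4 * n) ≡ u * (4 * n * (4 * n))
    expand = solve-∀
    exponent : 1 + n * u * s < u * (4 * n * (4 * n))
    exponent = begin-strict
      1 + n * u * s             <⟨ +-monoˡ-< (n * u * s) (≤-trans (s≤s (s≤s z≤n)) (*-monoˡ-≤ 8 pos)) ⟩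
      n * n * u * 8 + n * u * s ≡⟨ expand n u ⟩
      u * (4 * n * (4 * n))     ∎

  -- Non-edges have probability `k / suc k`, close to 1 for large `k`; hence `t` is `u * k` times as
  -- large as `s`.
  falseBound : ∀ {m} → m < 2 ^ (n * u) → 2 * (m ^ t * k ^ triangle t) < suc k ^ triangle t
  falseBound {m} m< = begin-strict
    2 * (m ^ t * k ^ triangle t)           ≡⟨ *-assoc 2 (m ^ t) _ ⟨
    2 * m ^ t * k ^ triangle t             <⟨ *-monoˡ-< (k ^ triangle t) {{m^n≢0 k (triangle t) {{m^n≢0 2 u}}}} power ⟩
    2 ^ (2 + n * u * t) * k ^ triangle t   ≤⟨ 2^j*k^e≤[1+k]^e k {{m^n≢0 2 u}} (2 + n * u * t) exponent ⟩
    suc k ^ triangle t                     ∎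
    where
    power : 2 * m ^ t < 2 ^ (2 + n * u * t)
    power = begin-strict
      2 * m ^ t                ≤⟨ *-monoʳ-≤ 2 (^-monoˡ-≤ t (<⇒≤ m<)) ⟩
      2 * (2 ^ (n * u)) ^ t    ≡⟨ cong (2 *_) (^-*-assoc 2 (n * u) t) ⟩
      2 ^ (1 + n * u * t)      <⟨ ^-monoʳ-< 2 (s≤s (s≤s z≤n)) (n<1+n (1 + n * u * t)) ⟩
      2 ^ (2 + n * u * t)      ∎
    pos : 1 ≤ n * u
    pos = *-mono-≤ (>-nonZero⁻¹ n) (>-nonZero⁻¹ u)
    a≥1 : 1 ≤ a
    a≥1 = *-mono-≤ (≤-trans pos (≤-trans (m≤n*m (n * u) 4) (≤-reflexive (sym (*-assoc 4 n u))))) (m^n>0 2 u)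
    expand : ∀ n u k a → k * (n * u * (2 * a) + n * u * (a + a)) ≡ 4 * n * u * k * a
    expand = solve-∀
    -- `n * u * (2 * a)` absorbs the 2, and then `k * n * u * 4 * a` is exactly `a * a`.
    exponent : k * (2 + n * u * t) ≤ triangle t
    exponent = begin
      k * (2 + n * u * t)                    ≤⟨ *-monoʳ-≤ k (+-monoˡ-≤ (n * u * t) (*-mono-≤ pos (*-monoʳ-≤ 2 a≥1))) ⟩
      k * (n * u * (2 * a) + n * u * t)      ≡⟨ expand n u k a ⟩
      a * a                                  ≤⟨ *≤triangle a a ⟩
      triangle t                             ∎

-- The step-up colouring

-- A graph on {0,…,m-1}: the row of a vertex records which later vertices are adjacent to it.
Graph : ℕ → Set
Graph zero    = ⊤
Graph (suc m) = Vec Bool m × Graph m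

-- The predicates ending in ? take the values 0 and 1 in ℕ, so that they can be integrated.
equal? : Bool → Bool → ℕ
equal? true  true  = 1
equal? true  false = 0
equal? false true  = 0
equal? false false = 1

equal?-refl : ∀ b → equal? b b ≡ 1
equal?-refl true  = refl
equal?-refl false = refl

constant? : ∀ {m} → Bool → Subset m → Vec Bool m → ℕ
constant? b []          []      = 1
constant? b (true  ∷ S) (c ∷ r) = equal? b c * constant? b S r
constant? b (false ∷ S) (c ∷ r) = constant? b S r

-- For `b = false` this indicates an independent set, so that one calculation serves both union
-- bounds.
clique? : ∀ {m} → Bool → Subset m → Graph m → ℕ
clique? b []          tt      = 1
clique? b (true  ∷ S) (r , g) = constant? b S r * clique? b S g
clique? b (false ∷ S) (r , g) = clique? b S g

infix 4 _≺_

-- Lexicographic order, that is, the leaves of the binary tree from left to right; the number of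
-- `there` is the level of the split.
data _≺_ : ∀ {m} → Vec Bool m → Vec Bool m → Set where
  here  : ∀ {m} {x y : Vec Bool m} → false ∷ x ≺ true ∷ y
  there : ∀ {m b} {x y : Vec Bool m} → x ≺ y → b ∷ x ≺ b ∷ y

≺-connex : ∀ {m} (x y : Vec Bool m) → x ≢ y → x ≺ y ⊎ y ≺ x
≺-connex [] [] x≢y = contradiction refl x≢y
≺-connex (false ∷ x) (true ∷ y) x≢y = inj₁ here
≺-connex (true ∷ x) (false ∷ y) x≢y = inj₂ here
≺-connex (false ∷ x) (false ∷ y) x≢y with ≺-connex x y (x≢y ∘ cong (false ∷_))
... | inj₁ x≺y = inj₁ (there x≺y)
... | inj₂ y≺x = inj₂ (there y≺x)
≺-connex (true ∷ x) (true ∷ y) x≢y with ≺-connex x y (x≢y ∘ cong (true ∷_))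
... | inj₁ x≺y = inj₁ (there x≺y)
... | inj₂ y≺x = inj₂ (there y≺x)

≺-irrefl : ∀ {m} {x : Vec Bool m} → ¬ x ≺ x
≺-irrefl (there x≺x) = ≺-irrefl x≺x

≺-asym : ∀ {m} {x y : Vec Bool m} → x ≺ y → ¬ y ≺ x
≺-asym (there x≺y) (there y≺x) = ≺-asym x≺y y≺x

-- The value false for x = y is junk.
entryAtSplit : ∀ {m} → Vec Bool m → Vec Bool m → Vec Bool m → Bool
entryAtSplit []      []          []          = false
entryAtSplit (c ∷ r) (false ∷ x) (true  ∷ y) = c
entryAtSplit (c ∷ r) (true  ∷ x) (false ∷ y) = c
entryAtSplit (c ∷ r) (false ∷ x) (false ∷ y) = entryAtSplit r x y
entryAtSplit (c ∷ r) (true  ∷ x) (true  ∷ y) = entryAtSplit r x y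

entryAtSplit-∷ : ∀ {m} c d (r x y : Vec Bool m) →
                 entryAtSplit (c ∷ r) (d ∷ x) (d ∷ y) ≡ entryAtSplit r x y
entryAtSplit-∷ c true  r x y = refl
entryAtSplit-∷ c false r x y = refl

-- Left and right name the side of the upper split on which the lower split lies.
leftColour rightColour : Bool → Fin 3
leftColour  b = if b then 0F else 1F
rightColour b = if b then 0F else 2F

edgeType : Fin 3 → Bool
edgeType 0F = true
edgeType _  = false

edgeType-left : ∀ b → edgeType (leftColour b) ≡ b
edgeType-left true  = refl
edgeType-left false = refl

edgeType-right : ∀ b → edgeType (rightColour b) ≡ b
edgeType-right true  = refl
edgeType-right false = refl

leftColour≢2 : ∀ b → leftColour b ≢ 2F
leftColour≢2 true  ()
leftColour≢2 false ()

rightColour≢1 : ∀ b → rightColour b ≢ 1F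
rightColour≢1 true  ()
rightColour≢1 false ()

-- Only sorted triples x ≺ y ≺ z matter; the default value is arbitrary.
stepUp : ∀ {m} → Graph m → (x y z : Vec Bool m) → Fin 3
stepUp {zero}  _       _           _           _           = 0F
stepUp {suc m} (r , g) (false ∷ x) (false ∷ y) (false ∷ z) = stepUp g x y z
stepUp {suc m} (r , g) (false ∷ x) (false ∷ y) (true  ∷ z) = leftColour (entryAtSplit r x y)
stepUp {suc m} (r , g) (false ∷ x) (true  ∷ y) (false ∷ z) = 0F
stepUp {suc m} (r , g) (false ∷ x) (true  ∷ y) (true  ∷ z) = rightColour (entryAtSplit r y z)
stepUp {suc m} (r , g) (true  ∷ x) (false ∷ y) (_     ∷ z) = 0F
stepUp {suc m} (r , g) (true  ∷ x) (true  ∷ y) (false ∷ z) = 0F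
stepUp {suc m} (r , g) (true  ∷ x) (true  ∷ y) (true  ∷ z) = stepUp g x y z

-- Monochromatic sets, their halves and their branching levels

Mono : ∀ {m} → Graph m → List (Vec Bool m) → Fin 3 → Set
Mono g xs c = ∀ {x y z} → x ∈ xs → y ∈ xs → z ∈ xs → x ≺ y → y ≺ z → stepUp g x y z ≡ c

half : ∀ {m} → Bool → List (Vec Bool (suc m)) → List (Vec Bool m)
half d     []                 = []
half false ((false ∷ x) ∷ xs) = x ∷ half false xs
half false ((true  ∷ x) ∷ xs) = half false xs
half true  ((false ∷ x) ∷ xs) = half true xs
half true  ((true  ∷ x) ∷ xs) = x ∷ half true xs

length-half : ∀ {m} (xs : List (Vec Bool (suc m))) →
              length xs ≡ length (half false xs) + length (half true xs)
length-half []                 = refl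
length-half ((false ∷ x) ∷ xs) = cong suc (length-half xs)
length-half ((true  ∷ x) ∷ xs) = trans (cong suc (length-half xs)) (sym (+-suc _ _))

∈-half : ∀ {m} d (xs : List (Vec Bool (suc m))) {x} → x ∈ half d xs → d ∷ x ∈ xs
∈-half false ((false ∷ x) ∷ xs) (here refl) = here refl
∈-half false ((false ∷ x) ∷ xs) (there x∈)  = there (∈-half false xs x∈)
∈-half false ((true  ∷ x) ∷ xs) x∈          = there (∈-half false xs x∈)
∈-half true  ((false ∷ x) ∷ xs) x∈          = there (∈-half true xs x∈)
∈-half true  ((true  ∷ x) ∷ xs) (here refl) = here refl
∈-half true  ((true  ∷ x) ∷ xs) (there x∈)  = there (∈-half true xs x∈)

half-≢ : ∀ {m} d {x : Vec Bool m} xs → All (d ∷ x ≢_) xs → All (x ≢_) (half d xs)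
half-≢ d xs x∉ = All.tabulate λ y∈ x≡y → All.lookup x∉ (∈-half d xs y∈) (cong (d ∷_) x≡y)

half-unique : ∀ {m} d {xs : List (Vec Bool (suc m))} → Unique xs → Unique (half d xs)
half-unique d     {[]}               []         = []
half-unique false {(false ∷ x) ∷ xs} (x∉ ∷ xs!) = half-≢ false xs x∉ ∷ half-unique false xs!
half-unique false {(true  ∷ x) ∷ xs} (x∉ ∷ xs!) = half-unique false xs!
half-unique true  {(false ∷ x) ∷ xs} (x∉ ∷ xs!) = half-unique true xs!
half-unique true  {(true  ∷ x) ∷ xs} (x∉ ∷ xs!) = half-≢ true xs x∉ ∷ half-unique true xs!

half-mono : ∀ {m} d {r} {g : Graph m} {xs c} → Mono (r , g) xs c → Mono g (half d xs) c
half-mono false {xs = xs} mono x∈ y∈ z∈ x≺y y≺z =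
  mono (∈-half false xs x∈) (∈-half false xs y∈) (∈-half false xs z∈) (there x≺y) (there y≺z)
half-mono true {xs = xs} mono x∈ y∈ z∈ x≺y y≺z =
  mono (∈-half true xs x∈) (∈-half true xs y∈) (∈-half true xs z∈) (there x≺y) (there y≺z)

-- Every level of S is a branching level of the trie spanned by xs, so what holds at
-- all branching levels holds on S.
Branching : ∀ {m} → List (Vec Bool m) → Subset m → Set
Branching xs S = ∀ r b → (∀ {x y} → x ∈ xs → y ∈ xs → x ≺ y → entryAtSplit r x y ≡ b) →
                 constant? b S r ≡ 1

record BranchingClique {m} (g : Graph m) (xs : List (Vec Bool m)) (b : Bool) (t : ℕ) : Set where
  constructor branchingClique
  field
    levels    : Subset m
    size      : ∣ levels ∣ ≡ t
    clique    : clique? b levels g ≡ 1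
    branching : Branching xs levels

-- A pair of `half d xs` splits one level deeper in `xs`, so levels that branch in one half branch
-- in the whole.
skipLevel : ∀ {m} d {r} {g : Graph m} xs {b t} →
            BranchingClique g (half d xs) b t → BranchingClique (r , g) xs b t
skipLevel d xs (branchingClique S size clique branching) =
  branchingClique (false ∷ S) size clique λ where
    (c ∷ r) b h → branching r b λ {x} {y} x∈ y∈ x≺y →
      trans (sym (entryAtSplit-∷ c d r x y)) (h (∈-half d xs x∈) (∈-half d xs y∈) (there x≺y))

emptyClique : ∀ {m} (g : Graph m) xs {b} → BranchingClique g xs b 0
emptyClique {zero}  tt      xs = branchingClique [] refl refl λ { [] _ _ → refl }
emptyClique {suc m} (r , g) xs = skipLevel false xs (emptyClique g (half false xs))

-- A pair branching below d at level j, together with an element of the opposite half, is a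
-- triple whose colour reveals the edge between level 0 and level j.
addLevel : ∀ {m} d {r} {g : Graph m} xs {c t x y} → Mono (r , g) xs c →
           x ∈ half false xs → y ∈ half true xs →
           BranchingClique g (half d xs) (edgeType c) t →
           BranchingClique (r , g) xs (edgeType c) (suc t)
addLevel d {r} {g} xs {c} mono x₀∈ y₀∈ (branchingClique S size clique branching) =
  branchingClique (true ∷ S) (cong suc size)
    -- `branching` is applied to the row of level 0: its entries are known where pairs of the half
    -- split, hence at all levels of `S`.
    (cong₂ _*_ (branching r (edgeType c) (entry d)) clique)
    λ where
      (e ∷ r′) b h → cong₂ _*_
        (trans (cong (equal? b) (h (∈-half false xs x₀∈) (∈-half true xs y₀∈) here)) (equal?-refl b))
        (branching r′ b λ {x} {y} x∈ y∈ x≺y →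
          trans (sym (entryAtSplit-∷ e d r′ x y)) (h (∈-half d xs x∈) (∈-half d xs y∈) (there x≺y)))
  where
  entry : ∀ d {x y} → x ∈ half d xs → y ∈ half d xs → x ≺ y → entryAtSplit r x y ≡ edgeType c
  entry false x∈ y∈ x≺y = trans (sym (edgeType-left _)) (cong edgeType
    (mono (∈-half false xs x∈) (∈-half false xs y∈) (∈-half true xs y₀∈) (there x≺y) here))
  entry true x∈ y∈ x≺y = trans (sym (edgeType-right _)) (cong edgeType
    (mono (∈-half false xs x₀∈) (∈-half true xs x∈) (∈-half true xs y∈) here (there x≺y)))

-- Extraction of branching cliques

empty⊎inhabited : ∀ {A : Set} (xs : List A) → length xs ≡ 0 ⊎ ∃ (_∈ xs)
empty⊎inhabited []       = inj₁ refl
empty⊎inhabited (x ∷ xs) = inj₂ (x , here refl)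

unique-Vec0 : ∀ {xs : List (Vec Bool 0)} → Unique xs → length xs ≤ 1
unique-Vec0 []                                      = z≤n
unique-Vec0 ([] ∷ [])                               = s≤s z≤n
unique-Vec0 {[] ∷ [] ∷ _} ((x≢y ∷ _) ∷ _) = contradiction refl x≢y

-- `φ t` is a number of points that forces `t` branching levels in colour `c`. Where both halves are
-- inhabited, one of them must retain `φ t` points; the colours differ in how fast points are lost.
Splits : Fin 3 → (ℕ → ℕ) → Set
Splits c φ = ∀ {m} {r : Vec Bool m} {g : Graph m} {xs x y} t → Unique xs → Mono (r , g) xs c →
             x ∈ half false xs → y ∈ half true xs →
             φ (suc t) ≤ length (half false xs) + length (half true xs) →
             ∃ λ d → φ t ≤ length (half d xs)

-- Descends the trie: a level with an empty half is skipped at no cost, any other joins the clique.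
-- By `φ≥2` the levels cannot run out while `t` is positive, since at most one point is left then.
extractClique : ∀ {c φ} → Splits c φ → (∀ t → 2 ≤ φ (suc t)) →
                ∀ {m} (g : Graph m) {xs} t → Unique xs → Mono g xs c → φ t ≤ length xs →
                BranchingClique g xs (edgeType c) t
extractClique split φ≥2 g zero xs! mono φt≤ = emptyClique g _
extractClique split φ≥2 {zero} g (suc t) xs! mono φt≤ =
  contradiction (≤-trans (φ≥2 t) (≤-trans φt≤ (unique-Vec0 xs!))) λ { (s≤s ()) }
extractClique {c} {φ} split φ≥2 {suc m} (r , g) {xs} (suc t) xs! mono φt≤
  with empty⊎inhabited (half false xs) | empty⊎inhabited (half true xs)
... | inj₁ L≡0 | _ = skipLevel true xs
      (extractClique split φ≥2 g (suc t) (half-unique true xs!) (half-mono true {r = r} mono)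
        (subst (λ k → φ (suc t) ≤ k + length (half true xs)) L≡0 (subst (φ (suc t) ≤_) (length-half xs) φt≤)))
... | inj₂ _ | inj₁ R≡0 = skipLevel false xs
      (extractClique split φ≥2 g (suc t) (half-unique false xs!) (half-mono false {r = r} mono)
        (subst (φ (suc t) ≤_) (trans (cong (length (half false xs) +_) R≡0) (+-identityʳ _))
          (subst (φ (suc t) ≤_) (length-half xs) φt≤)))
... | inj₂ (x , x∈) | inj₂ (y , y∈)
  with d , φt≤d ← split {r = r} {g} {xs} t xs! mono x∈ y∈ (subst (φ (suc t) ≤_) (length-half xs) φt≤) =
  addLevel d xs mono x∈ y∈
    (extractClique split φ≥2 g t (half-unique d xs!) (half-mono d {r = r} mono) φt≤d)

-- Pigeonhole: one of the halves holds at least half of the points.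
split-0 : Splits 0F (2 ^_)
split-0 {xs = xs} t _ _ _ _ h with 2 ^ t ≤? length (half false xs) | 2 ^ t ≤? length (half true xs)
... | yes p | _     = false , p
... | no _  | yes p = true , p
... | no p  | no q  = contradiction h
  (<⇒≱ (+-mono-< (≰⇒> p) (subst (_ <_) (sym (+-identityʳ _)) (≰⇒> q))))

ordered-pair : ∀ {m} {xs : List (Vec Bool m)} → Unique xs → 2 ≤ length xs →
               ∃ λ x → ∃ λ y → x ∈ xs × y ∈ xs × x ≺ y
ordered-pair {xs = x ∷ []} _ (s≤s ())
ordered-pair {xs = x ∷ y ∷ _} ((x≢y ∷ _) ∷ _) _ with ≺-connex x y x≢y
... | inj₁ x≺y = x , y , here refl , there (here refl) , x≺y
... | inj₂ y≺x = y , x , there (here refl) , here refl , y≺x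

-- Two points of the right half and one of the left would have a colour given by `rightColour`,
-- which is never 1. So the right half has at most one point, and the left keeps the rest.
split-1 : Splits 1F suc
split-1 {r = r} {xs = xs} {x = x} t xs! mono x∈ _ h with length (half true xs) ≤? 1
... | yes R≤1 = false , +-cancelʳ-≤ 1 _ _
        (≤-trans (≤-reflexive (+-comm _ 1)) (≤-trans h (+-monoʳ-≤ (length (half false xs)) R≤1)))
... | no R≰1 with y , z , y∈ , z∈ , y≺z ← ordered-pair (half-unique true xs!) (≰⇒> R≰1) =
  contradiction (mono (∈-half false xs x∈) (∈-half true xs y∈) (∈-half true xs z∈) here (there y≺z))
    (rightColour≢1 (entryAtSplit r y z))

-- The mirror image of `split-1`: here the left half has at most one point.
split-2 : Splits 2F suc
split-2 {r = r} {xs = xs} {y = z} t xs! mono _ z∈ h with length (half false xs) ≤? 1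
... | yes L≤1 = true , s≤s⁻¹ (≤-trans h (+-monoˡ-≤ (length (half true xs)) L≤1))
... | no L≰1 with x , y , x∈ , y∈ , x≺y ← ordered-pair (half-unique false xs!) (≰⇒> L≰1) =
  contradiction (mono (∈-half false xs x∈) (∈-half false xs y∈) (∈-half true xs z∈) (there x≺y) here)
    (leftColour≢2 (entryAtSplit r x y))

CliqueFree : ∀ {m} → Graph m → Bool → ℕ → Set
CliqueFree g b t = ∀ S → ∣ S ∣ ≡ t → clique? b S g ≡ 0

stepUp-avoids : ∀ {m s t} {g : Graph m} → CliqueFree g true s → CliqueFree g false t →
                ∀ {xs} → Unique xs → 2 ^ s ≤ length xs → suc t ≤ length xs → ∀ c → ¬ Mono g xs c
stepUp-avoids {m} {s} {t} {g} red blue {xs} xs! 2^s≤ t< = λ where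
    0F mono → refute red  (extractClique split-0 (λ t → *-monoʳ-≤ 2 (m^n>0 2 t)) g s xs! mono 2^s≤)
    1F mono → refute blue (extractClique split-1 (λ t → s≤s (s≤s z≤n)) g t xs! mono t<)
    2F mono → refute blue (extractClique split-2 (λ t → s≤s (s≤s z≤n)) g t xs! mono t<)
  where
  refute : ∀ {b t} → CliqueFree g b t → ¬ BranchingClique g xs b t
  refute free (branchingClique S size clique _) = contradiction (trans (sym clique) (free S size)) λ ()

-- Transfer to numbers by binary expansion

isOne : Fin 2 → Bool
isOne 0F = false
isOne 1F = true

-- Most significant digit first, so that the order of numbers becomes `_≺_`.
binary : ∀ m → Fin (2 ^ m) → Vec Bool m
binary zero    _ = []
binary (suc m) i = isOne (proj₁ (remQuot {2} (2 ^ m) i)) ∷ binary m (proj₂ (remQuot {2} (2 ^ m) i))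

binary-mono : ∀ m {i j} → i Fin.< j → binary m i ≺ binary m j
binary-mono zero {0F} {0F} ()
binary-mono (suc m) {i} {j} i<j = compareDigits _ _ _ _
  (subst₂ Fin._<_ (sym (Fin.combine-remQuot {2} (2 ^ m) i)) (sym (Fin.combine-remQuot {2} (2 ^ m) j)) i<j)
  where
  cancelDigit : ∀ (h : Fin 2) (i′ j′ : Fin (2 ^ m)) → combine h i′ Fin.< combine h j′ → i′ Fin.< j′
  cancelDigit h i′ j′ lt = +-cancelˡ-< (2 ^ m * toℕ h) _ _
    (subst₂ _<_ (Fin.toℕ-combine h i′) (Fin.toℕ-combine h j′) lt)
  compareDigits : ∀ (h k : Fin 2) (i′ j′ : Fin (2 ^ m)) → combine h i′ Fin.< combine k j′ →
                  isOne h ∷ binary m i′ ≺ isOne k ∷ binary m j′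
  compareDigits 0F 0F i′ j′ lt = there (binary-mono m (cancelDigit 0F i′ j′ lt))
  compareDigits 0F 1F i′ j′ lt = here
  compareDigits 1F 0F i′ j′ lt =
    contradiction (Fin.combine-monoˡ-< {2} {i = 0F} {j = 1F} j′ i′ (s≤s z≤n)) (<-asym lt)
  compareDigits 1F 1F i′ j′ lt = there (binary-mono m (cancelDigit 1F i′ j′ lt))

module _ {m l : ℕ} (x : Fin l → Vec Bool m) (x-mono : ∀ {a b} → a Fin.< b → x a ≺ x b) where

  mono⇒injective : ∀ {a b} → x a ≡ x b → a ≡ b
  mono⇒injective {a} {b} eq with Fin.<-cmp a b
  ... | tri< a<b _ _ = contradiction (subst (_≺ x b) eq (x-mono a<b)) ≺-irrefl
  ... | tri≈ _ a≡b _ = a≡b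
  ... | tri> _ _ b<a = contradiction (subst (x b ≺_) eq (x-mono b<a)) ≺-irrefl

  -- Trichotomy. `Mono` compares points and `Monochromatic` compares indices; this leads from the
  -- former to the latter.
  mono⇒reflects : ∀ {a b} → x a ≺ x b → a Fin.< b
  mono⇒reflects {a} {b} xa≺xb with Fin.<-cmp a b
  ... | tri< a<b _ _  = a<b
  ... | tri≈ _ refl _ = contradiction xa≺xb ≺-irrefl
  ... | tri> _ _ b<a  = contradiction xa≺xb (≺-asym (x-mono b<a))

avoids : ∀ {m s t l} (g : Graph m) → CliqueFree g true s → CliqueFree g false t →
         2 ^ s ≤ l → suc t ≤ l → Avoids (2 ^ m) l
avoids {m} {s} {t} {l} g red blue 2^s≤l t<l = χ , λ f f-mono c mono →
    let x      = binary m ∘ f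
        x-mono = λ {a} {b} a<b → binary-mono m (f-mono a b a<b)
        |x|    = sym (length-tabulate x)
    in stepUp-avoids red blue (tabulate⁺ (mono⇒injective x x-mono))
         (subst (2 ^ s ≤_) |x| 2^s≤l) (subst (suc t ≤_) |x| t<l) c
         (mono-tabulate f c mono (mono⇒reflects x x-mono))
  where
  χ : Colouring3 (2 ^ m)
  χ i j k = stepUp g (binary m i) (binary m j) (binary m k)

  mono-tabulate : ∀ (f : Fin l → Fin (2 ^ m)) c → Monochromatic χ f c →
                  (∀ {a b} → binary m (f a) ≺ binary m (f b) → a Fin.< b) →
                  Mono g (tabulate (binary m ∘ f)) c
  mono-tabulate f c mono reflects x∈ y∈ z∈ x≺y y≺z
    with a , refl ← ∈-tabulate⁻ x∈ | b , refl ← ∈-tabulate⁻ y∈ | d , refl ← ∈-tabulate⁻ z∈ =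
    mono a b d (reflects x≺y) (reflects y≺z)

-- Random graphs

-- Integration against integer weights, not normalised so that all calculation stays in `ℕ`: a
-- probability is a ratio to `mass`. The field `attained` is the first moment principle, in a form
-- that passes to products.
record Measure (X : Set) : Set where
  field
    ∫        : (X → ℕ) → ℕ
    ∫-cong   : ∀ {f g} → (∀ x → f x ≡ g x) → ∫ f ≡ ∫ g
    ∫-+      : ∀ f g → ∫ (λ x → f x + g x) ≡ ∫ f + ∫ g
    ∫-*      : ∀ c f → ∫ (λ x → c * f x) ≡ c * ∫ f
    mass>0   : 0 < ∫ (λ _ → 1)
    attained : ∀ f → ∃ λ x → f x * ∫ (λ _ → 1) ≤ ∫ f

  mass : ℕ
  mass = ∫ (λ _ → 1)

  ∫-const : ∀ c → ∫ (λ _ → c) ≡ c * mass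
  ∫-const c = trans (∫-cong λ _ → sym (*-identityʳ c)) (∫-* c (λ _ → 1))

open Measure

dirac : Measure ⊤
dirac = record
  { ∫ = λ f → f tt ; ∫-cong = λ eq → eq tt ; ∫-+ = λ _ _ → refl ; ∫-* = λ _ _ → refl
  ; mass>0 = s≤s z≤n ; attained = λ f → tt , ≤-reflexive (*-identityʳ (f tt)) }

coin : ℕ → Measure Bool
coin k = record
  { ∫        = λ f → f true + k * f false
  ; ∫-cong   = λ eq → cong₂ (λ p q → p + k * q) (eq true) (eq false)
  ; ∫-+      = λ f g → add k (f true) (f false) (g true) (g false)
  ; ∫-*      = λ c f → scale k c (f true) (f false)
  ; mass>0   = s≤s z≤n
  ; attained = attained′
  }
  where
  add : ∀ k a b c d → a + c + k * (b + d) ≡ a + k * b + (c + k * d)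
  add = solve-∀
  scale : ∀ k c a b → c * a + k * (c * b) ≡ c * (a + k * b)
  scale = solve-∀
  expand : ∀ k a → a * (1 + k * 1) ≡ a + k * a
  expand = solve-∀
  attained′ : ∀ f → ∃ λ x → f x * (1 + k * 1) ≤ f true + k * f false
  attained′ f with ≤-total (f true) (f false)
  ... | inj₁ ft≤ff = true , ≤-trans (≤-reflexive (expand k (f true)))
                            (+-monoʳ-≤ (f true) (*-monoʳ-≤ k ft≤ff))
  ... | inj₂ ff≤ft = false , ≤-trans (≤-reflexive (expand k (f false)))
                            (+-monoˡ-≤ (k * f false) ff≤ft)

infixr 2 _⊗_

_⊗_ : ∀ {X Y} → Measure X → Measure Y → Measure (X × Y)
μ ⊗ ν = record
  { ∫        = ∫∫
  ; ∫-cong   = λ eq → ∫-cong μ λ x → ∫-cong ν λ y → eq (x , y)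
  ; ∫-+      = λ f g → trans (∫-cong μ λ x → ∫-+ ν (λ y → f (x , y)) (λ y → g (x , y))) (∫-+ μ _ _)
  ; ∫-*      = λ c f → trans (∫-cong μ λ x → ∫-* ν c (λ y → f (x , y))) (∫-* μ c _)
  ; mass>0   = subst (0 <_) (sym mass-⊗) (*-mono-≤ (mass>0 ν) (mass>0 μ))
  ; attained = attained′
  }
  where
  ∫∫ : (_ → ℕ) → ℕ
  ∫∫ f = ∫ μ λ x → ∫ ν λ y → f (x , y)
  mass-⊗ : ∫∫ (λ _ → 1) ≡ mass ν * mass μ
  mass-⊗ = ∫-const μ (mass ν)
  -- First an `x` whose inner integral is at most average, then a `y` that is at most average for
  -- this `x`.
  attained′ : ∀ f → ∃ λ p → f p * ∫∫ (λ _ → 1) ≤ ∫∫ f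
  attained′ f with x , x≤ ← attained μ (λ x → ∫ ν λ y → f (x , y))
              with y , y≤ ← attained ν (λ y → f (x , y)) = (x , y) , (begin
    f (x , y) * ∫∫ (λ _ → 1)            ≡⟨ cong (f (x , y) *_) mass-⊗ ⟩
    f (x , y) * (mass ν * mass μ)       ≡⟨ *-assoc (f (x , y)) _ _ ⟨
    f (x , y) * mass ν * mass μ         ≤⟨ *-monoˡ-≤ (mass μ) y≤ ⟩
    ∫ ν (λ y → f (x , y)) * mass μ      ≤⟨ x≤ ⟩
    ∫∫ f                                ∎)
    where open ≤-Reasoning

pushforward : ∀ {X Y} → (X → Y) → Measure X → Measure Y
pushforward φ μ = record
  { ∫ = λ f → ∫ μ (f ∘ φ) ; ∫-cong = λ eq → ∫-cong μ (eq ∘ φ)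
  ; ∫-+ = λ f g → ∫-+ μ (f ∘ φ) (g ∘ φ) ; ∫-* = λ c f → ∫-* μ c (f ∘ φ)
  ; mass>0 = mass>0 μ ; attained = λ f → let x , x≤ = attained μ (f ∘ φ) in φ x , x≤ }

coins : ∀ k m → Measure (Vec Bool m)
coins k zero    = pushforward (λ _ → []) dirac
coins k (suc m) = pushforward (uncurry _∷_) (coin k ⊗ coins k m)

-- Every edge is present with probability 1/(1+k), independently.
randomGraph : ∀ k m → Measure (Graph m)
randomGraph k zero    = dirac
randomGraph k (suc m) = coins k m ⊗ randomGraph k m

-- Probability that a given set is a clique or independent

weight : ℕ → Bool → ℕ
weight k true  = 1
weight k false = k

∫-equal? : ∀ k b → ∫ (coin k) (equal? b) ≡ weight k b
∫-equal? k true  = cong suc (*-zeroʳ k)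
∫-equal? k false = *-identityʳ k

∫-product : ∀ {X Y} (μ : Measure X) (ν : Measure Y) f g →
            ∫ (μ ⊗ ν) (λ (x , y) → f x * g y) ≡ ∫ μ f * ∫ ν g
∫-product μ ν f g = begin
  ∫ μ (λ x → ∫ ν (λ y → f x * g y)) ≡⟨ ∫-cong μ (λ x → trans (∫-* ν (f x) g) (*-comm (f x) (∫ ν g))) ⟩
  ∫ μ (λ x → ∫ ν g * f x)           ≡⟨ ∫-* μ (∫ ν g) f ⟩
  ∫ ν g * ∫ μ f                     ≡⟨ *-comm (∫ ν g) (∫ μ f) ⟩
  ∫ μ f * ∫ ν g                     ∎
  where open ≡-Reasoning

∫-second : ∀ {X Y} (μ : Measure X) (ν : Measure Y) g → ∫ (μ ⊗ ν) (g ∘ proj₂) ≡ ∫ ν g * mass μ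
∫-second μ ν g = ∫-const μ (∫ ν g)

mass-⊗ : ∀ {X Y} (μ : Measure X) (ν : Measure Y) → mass (μ ⊗ ν) ≡ mass ν * mass μ
mass-⊗ μ ν = ∫-second μ ν (λ _ → 1)

-- Independence: each coin of `S` contributes the probability `weight k b / suc k`, every other coin
-- a factor 1. Denominators are cleared.
∫-constant? : ∀ k b {m} (S : Subset m) →
              ∫ (coins k m) (constant? b S) * suc k ^ ∣ S ∣ ≡ weight k b ^ ∣ S ∣ * mass (coins k m)
∫-constant? k b [] = refl
∫-constant? k b {suc m} (true ∷ S) = begin
  ∫ (coin k ⊗ coins k m) (λ (c , r) → equal? b c * constant? b S r) * (suc k * suc k ^ ∣ S ∣)
    ≡⟨ cong (_* (suc k * suc k ^ ∣ S ∣)) (∫-product (coin k) (coins k m) (equal? b) (constant? b S)) ⟩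
  ∫ (coin k) (equal? b) * ∫ (coins k m) (constant? b S) * (suc k * suc k ^ ∣ S ∣)
    ≡⟨ regroup (∫ (coin k) (equal? b)) (∫ (coins k m) (constant? b S)) k (suc k ^ ∣ S ∣) ⟩
  ∫ (coin k) (equal? b) * (∫ (coins k m) (constant? b S) * suc k ^ ∣ S ∣) * (1 + k * 1)
    ≡⟨ cong₂ (λ p q → p * q * (1 + k * 1)) (∫-equal? k b) (∫-constant? k b S) ⟩
  weight k b * (weight k b ^ ∣ S ∣ * mass (coins k m)) * (1 + k * 1)
    ≡⟨ reassoc (weight k b) (weight k b ^ ∣ S ∣) (mass (coins k m)) (1 + k * 1) ⟩
  weight k b * weight k b ^ ∣ S ∣ * (mass (coins k m) * (1 + k * 1))
    ≡⟨ cong (weight k b * weight k b ^ ∣ S ∣ *_) (mass-⊗ (coin k) (coins k m)) ⟨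
  weight k b * weight k b ^ ∣ S ∣ * mass (coin k ⊗ coins k m) ∎
  where
  open ≡-Reasoning
  regroup : ∀ e f k p → e * f * (suc k * p) ≡ e * (f * p) * (1 + k * 1)
  regroup = solve-∀
  reassoc : ∀ a b c d → a * (b * c) * d ≡ a * b * (c * d)
  reassoc = solve-∀
∫-constant? k b {suc m} (false ∷ S) = begin
  ∫ (coin k ⊗ coins k m) (λ (c , r) → constant? b S r) * suc k ^ ∣ S ∣
    ≡⟨ cong (_* suc k ^ ∣ S ∣) (∫-second (coin k) (coins k m) (constant? b S)) ⟩
  ∫ (coins k m) (constant? b S) * (1 + k * 1) * suc k ^ ∣ S ∣
    ≡⟨ swap (∫ (coins k m) (constant? b S)) (1 + k * 1) (suc k ^ ∣ S ∣) ⟩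
  ∫ (coins k m) (constant? b S) * suc k ^ ∣ S ∣ * (1 + k * 1)
    ≡⟨ cong (_* (1 + k * 1)) (∫-constant? k b S) ⟩
  weight k b ^ ∣ S ∣ * mass (coins k m) * (1 + k * 1)
    ≡⟨ *-assoc (weight k b ^ ∣ S ∣) _ _ ⟩
  weight k b ^ ∣ S ∣ * (mass (coins k m) * (1 + k * 1))
    ≡⟨ cong (weight k b ^ ∣ S ∣ *_) (mass-⊗ (coin k) (coins k m)) ⟨
  weight k b ^ ∣ S ∣ * mass (coin k ⊗ coins k m) ∎
  where
  open ≡-Reasoning
  swap : ∀ a b c → a * b * c ≡ a * c * b
  swap = solve-∀

-- The row of the first vertex is independent of the later rows. If this vertex is in the set, its
-- row contributes one factor for each later vertex of the set, as in the recursion of `triangle`.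
∫-clique? : ∀ k b {m} (S : Subset m) →
            ∫ (randomGraph k m) (clique? b S) * suc k ^ triangle ∣ S ∣
            ≡ weight k b ^ triangle ∣ S ∣ * mass (randomGraph k m)
∫-clique? k b [] = refl
∫-clique? k b {suc m} (true ∷ S) = begin
  ∫ (ρ ⊗ γ) (λ (r , g) → constant? b S r * clique? b S g) * suc k ^ (∣ S ∣ + triangle ∣ S ∣)
    ≡⟨ cong₂ _*_ (∫-product ρ γ (constant? b S) (clique? b S)) (^-distribˡ-+-* (suc k) ∣ S ∣ _) ⟩
  ∫ ρ (constant? b S) * ∫ γ (clique? b S) * (suc k ^ ∣ S ∣ * suc k ^ triangle ∣ S ∣)
    ≡⟨ interchange (∫ ρ (constant? b S)) (∫ γ (clique? b S)) (suc k ^ ∣ S ∣) _ ⟩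
  (∫ ρ (constant? b S) * suc k ^ ∣ S ∣) * (∫ γ (clique? b S) * suc k ^ triangle ∣ S ∣)
    ≡⟨ cong₂ _*_ (∫-constant? k b S) (∫-clique? k b S) ⟩
  (w ^ ∣ S ∣ * mass ρ) * (w ^ triangle ∣ S ∣ * mass γ)
    ≡⟨ interchange′ (w ^ ∣ S ∣) (mass ρ) (w ^ triangle ∣ S ∣) (mass γ) ⟩
  w ^ ∣ S ∣ * w ^ triangle ∣ S ∣ * (mass γ * mass ρ)
    ≡⟨ cong₂ _*_ (^-distribˡ-+-* w ∣ S ∣ _) (mass-⊗ ρ γ) ⟨
  w ^ (∣ S ∣ + triangle ∣ S ∣) * mass (ρ ⊗ γ) ∎
  where
  open ≡-Reasoning
  ρ = coins k m
  γ = randomGraph k m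
  w = weight k b
  interchange : ∀ a b c d → a * b * (c * d) ≡ (a * c) * (b * d)
  interchange = solve-∀
  interchange′ : ∀ a b c d → (a * b) * (c * d) ≡ a * c * (d * b)
  interchange′ = solve-∀
∫-clique? k b {suc m} (false ∷ S) = begin
  ∫ (ρ ⊗ γ) (λ (r , g) → clique? b S g) * suc k ^ triangle ∣ S ∣
    ≡⟨ cong (_* suc k ^ triangle ∣ S ∣) (∫-second ρ γ (clique? b S)) ⟩
  ∫ γ (clique? b S) * mass ρ * suc k ^ triangle ∣ S ∣
    ≡⟨ swap (∫ γ (clique? b S)) (mass ρ) _ ⟩
  ∫ γ (clique? b S) * suc k ^ triangle ∣ S ∣ * mass ρ
    ≡⟨ cong (_* mass ρ) (∫-clique? k b S) ⟩
  w ^ triangle ∣ S ∣ * mass γ * mass ρ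
    ≡⟨ *-assoc (w ^ triangle ∣ S ∣) _ _ ⟩
  w ^ triangle ∣ S ∣ * (mass γ * mass ρ)
    ≡⟨ cong (w ^ triangle ∣ S ∣ *_) (mass-⊗ ρ γ) ⟨
  w ^ triangle ∣ S ∣ * mass (ρ ⊗ γ) ∎
  where
  open ≡-Reasoning
  ρ = coins k m
  γ = randomGraph k m
  w = weight k b
  swap : ∀ a b c → a * b * c ≡ a * c * b
  swap = solve-∀

-- The union bound over subsets of a given size

∑Subsets : ∀ m → ℕ → (Subset m → ℕ) → ℕ
∑Subsets zero    zero    h = h []
∑Subsets zero    (suc s) h = 0
∑Subsets (suc m) zero    h = ∑Subsets m zero (h ∘ (false ∷_))
∑Subsets (suc m) (suc s) h = ∑Subsets m (suc s) (h ∘ (false ∷_)) + ∑Subsets m s (h ∘ (true ∷_))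

≤-∑Subsets : ∀ {m} s (h : Subset m → ℕ) S → ∣ S ∣ ≡ s → h S ≤ ∑Subsets m s h
≤-∑Subsets zero    h []          _    = ≤-refl
≤-∑Subsets zero    h (false ∷ S) size = ≤-∑Subsets zero (h ∘ (false ∷_)) S size
≤-∑Subsets (suc s) h (false ∷ S) size = ≤-trans (≤-∑Subsets (suc s) (h ∘ (false ∷_)) S size) (m≤m+n _ _)
≤-∑Subsets (suc s) h (true ∷ S)  size =
  ≤-trans (≤-∑Subsets s (h ∘ (true ∷_)) S (suc-injective size)) (m≤n+m _ (∑Subsets _ (suc s) (h ∘ (false ∷_))))

-- At most `m ^ s` subsets have size `s`: sorting them by the first element, `m * m ^ s + m ^ s =
-- suc m * m ^ s ≤ suc m ^ suc s`.
∑Subsets-bound : ∀ m s {h c d} → (∀ S → ∣ S ∣ ≡ s → h S * c ≤ d) → ∑Subsets m s h * c ≤ m ^ s * d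
-- `0 ^ 0 = 1` counts the empty set.
∑Subsets-bound zero    zero    {d = d} h≤ = ≤-trans (h≤ [] refl) (≤-reflexive (sym (*-identityˡ d)))
∑Subsets-bound zero    (suc s) h≤ = z≤n
∑Subsets-bound (suc m) zero    h≤ = ∑Subsets-bound m zero (λ S → h≤ (false ∷ S))
∑Subsets-bound (suc m) (suc s) {h} {c} {d} h≤ = begin
  (∑Subsets m (suc s) h₀ + ∑Subsets m s h₁) * c
    ≡⟨ *-distribʳ-+ c (∑Subsets m (suc s) h₀) _ ⟩
  ∑Subsets m (suc s) h₀ * c + ∑Subsets m s h₁ * c
    ≤⟨ +-mono-≤ (∑Subsets-bound m (suc s) λ S → h≤ (false ∷ S))
                (∑Subsets-bound m s λ S size → h≤ (true ∷ S) (cong suc size)) ⟩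
  m * m ^ s * d + m ^ s * d
    ≡⟨ *-distribʳ-+ d (m * m ^ s) _ ⟨
  (m * m ^ s + m ^ s) * d
    ≡⟨ cong (_* d) (+-comm (m * m ^ s) _) ⟩
  suc m * m ^ s * d
    ≤⟨ *-monoˡ-≤ d (*-monoʳ-≤ (suc m) (^-monoˡ-≤ s (n≤1+n m))) ⟩
  suc m ^ suc s * d ∎
  where
  open ≤-Reasoning
  h₀ h₁ : Subset m → ℕ
  h₀ = h ∘ (false ∷_)
  h₁ = h ∘ (true ∷_)

∫-∑Subsets : ∀ {X} (μ : Measure X) m s (h : X → Subset m → ℕ) →
      ∫ μ (λ x → ∑Subsets m s (h x)) ≡ ∑Subsets m s (λ S → ∫ μ (λ x → h x S))
∫-∑Subsets μ zero    zero    h = refl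
∫-∑Subsets μ zero    (suc s) h = ∫-* μ 0 (λ _ → 0)
∫-∑Subsets μ (suc m) zero    h = ∫-∑Subsets μ m zero (λ x → h x ∘ (false ∷_))
∫-∑Subsets μ (suc m) (suc s) h = trans (∫-+ μ _ _)
  (cong₂ _+_ (∫-∑Subsets μ m (suc s) (λ x → h x ∘ (false ∷_))) (∫-∑Subsets μ m s (λ x → h x ∘ (true ∷_))))

cliques : ∀ {m} → Bool → ℕ → Graph m → ℕ
cliques {m} b s g = ∑Subsets m s (λ S → clique? b S g)

∫-cliques : ∀ k b m s → ∫ (randomGraph k m) (cliques b s) * suc k ^ triangle s
                        ≤ m ^ s * (weight k b ^ triangle s * mass (randomGraph k m))
∫-cliques k b m s = begin
  ∫ γ (cliques b s) * suc k ^ triangle s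
    ≡⟨ cong (_* suc k ^ triangle s) (∫-∑Subsets γ m s (λ g S → clique? b S g)) ⟩
  ∑Subsets m s (λ S → ∫ γ (clique? b S)) * suc k ^ triangle s
    ≤⟨ ∑Subsets-bound m s (λ { S refl → ≤-reflexive (∫-clique? k b S) }) ⟩
  m ^ s * (weight k b ^ triangle s * mass γ) ∎
  where
  open ≤-Reasoning
  γ = randomGraph k m

-- One half, so that cliques and independent sets together have expected number below 1.
∫-cliques<½ : ∀ k b m s → 2 * (m ^ s * weight k b ^ triangle s) < suc k ^ triangle s →
              2 * ∫ (randomGraph k m) (cliques b s) < mass (randomGraph k m)
∫-cliques<½ k b m s h = *-cancelʳ-< (suc k ^ triangle s) _ _ (begin-strict
  2 * ∫ γ (cliques b s) * suc k ^ triangle s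
    ≡⟨ *-assoc 2 (∫ γ (cliques b s)) _ ⟩
  2 * (∫ γ (cliques b s) * suc k ^ triangle s)
    ≤⟨ *-monoʳ-≤ 2 (∫-cliques k b m s) ⟩
  2 * (m ^ s * (weight k b ^ triangle s * mass γ))
    ≡⟨ reassoc (m ^ s) (weight k b ^ triangle s) (mass γ) ⟩
  2 * (m ^ s * weight k b ^ triangle s) * mass γ
    <⟨ *-monoˡ-< (mass γ) {{>-nonZero (mass>0 γ)}} h ⟩
  suc k ^ triangle s * mass γ
    ≡⟨ *-comm _ (mass γ) ⟩
  mass γ * suc k ^ triangle s ∎)
  where
  open ≤-Reasoning
  γ = randomGraph k m
  reassoc : ∀ a b c → 2 * (a * (b * c)) ≡ 2 * (a * b) * c
  reassoc = solve-∀

-- First moment method: the expected number of bad sets is below 1, so some graph has none.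
ramseyGraph : ∀ k m s t → 2 * m ^ s < suc k ^ triangle s →
              2 * (m ^ t * k ^ triangle t) < suc k ^ triangle t →
              ∃ λ (g : Graph m) → CliqueFree g true s × CliqueFree g false t
ramseyGraph k m s t red blue = g , free s true (m≤m+n _ _) , free t false (m≤n+m _ _)
  where
  open ≤-Reasoning
  γ = randomGraph k m
  bad : Graph m → ℕ
  bad g = cliques true s g + cliques false t g
  red′ : 2 * (m ^ s * 1 ^ triangle s) < suc k ^ triangle s
  red′ = subst (λ p → 2 * p < suc k ^ triangle s)
    (sym (trans (cong (m ^ s *_) (^-zeroˡ (triangle s))) (*-identityʳ (m ^ s)))) red
  expected : ∫ γ bad < mass γ
  expected = *-cancelˡ-< 2 _ _ (begin-strict
    2 * ∫ γ bad                                            ≡⟨ cong (2 *_) (∫-+ γ (cliques true s) (cliques false t)) ⟩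
    2 * (∫ γ (cliques true s) + ∫ γ (cliques false t))     ≡⟨ *-distribˡ-+ 2 (∫ γ (cliques true s)) _ ⟩
    2 * ∫ γ (cliques true s) + 2 * ∫ γ (cliques false t)   <⟨ +-mono-< (∫-cliques<½ k true m s red′) (∫-cliques<½ k false m t blue) ⟩
    mass γ + mass γ                                        ≡⟨ cong (mass γ +_) (+-identityʳ (mass γ)) ⟨
    2 * mass γ                                             ∎)
  g : Graph m
  g = proj₁ (attained γ bad)
  bad≡0 : bad g ≡ 0
  bad≡0 = n<1⇒n≡0 (*-cancelʳ-< (mass γ) _ _ (begin-strict
    bad g * mass γ ≤⟨ proj₂ (attained γ bad) ⟩
    ∫ γ bad        <⟨ expected ⟩
    mass γ         ≡⟨ *-identityˡ (mass γ) ⟨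
    1 * mass γ     ∎))
  free : ∀ s b → cliques b s g ≤ bad g → CliqueFree g b s
  free s b ≤bad S size = n≤0⇒n≡0 (begin
    clique? b S g  ≤⟨ ≤-∑Subsets s (λ S → clique? b S g) S size ⟩
    cliques b s g  ≤⟨ ≤bad ⟩
    bad g          ≡⟨ bad≡0 ⟩
    0              ∎)

-- Choice of parameters

-- Takes logarithms within `ℕ`: `l < 2 ^ suc ⌊log₂ l ⌋ ≤ 2 ^ (n * q)`, after which the exponent `q`
-- cancels.
<2^-exponent : ∀ q n {m l} u → suc ⌊log₂ l ⌋ ≤ n * q → m ^ q < l ^ u → m < 2 ^ (n * u)
<2^-exponent q n {m} {l} u 1+x≤nq m^q< = ^-cancelˡ-< q {m} {2 ^ (n * u)} (begin-strict
  m ^ q                     <⟨ m^q< ⟩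
  l ^ u                     ≤⟨ ^-monoˡ-≤ u (<⇒≤ (<2^1+⌊log₂⌋ l)) ⟩
  (2 ^ suc ⌊log₂ l ⌋) ^ u   ≡⟨ ^-*-assoc 2 (suc ⌊log₂ l ⌋) u ⟩
  2 ^ (suc ⌊log₂ l ⌋ * u)   ≤⟨ ^-monoʳ-≤ 2 (*-monoˡ-≤ u 1+x≤nq) ⟩
  2 ^ (n * q * u)           ≡⟨ cong (2 ^_) (swap n q u) ⟩
  2 ^ (n * u * q)           ≡⟨ ^-*-assoc 2 (n * u) q ⟨
  (2 ^ (n * u)) ^ q         ∎)
  where
  open ≤-Reasoning
  swap : ∀ n q u → n * q * u ≡ n * u * q
  swap = solve-∀

n<[1+n/16]*16 : ∀ n → n < suc (n / 16) * 16
n<[1+n/16]*16 n = begin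
  suc n                       ≡⟨ cong suc (m≡m%n+[m/n]*n n 16) ⟩
  suc (n % 16) + n / 16 * 16  ≤⟨ +-monoˡ-≤ (n / 16 * 16) (m%n<n n 16) ⟩
  suc (n / 16) * 16           ∎
  where open ≤-Reasoning

8*[1+n/16]≤n : ∀ n → 16 ≤ n → 8 * suc (n / 16) ≤ n
8*[1+n/16]≤n n 16≤n = begin
  8 * suc (n / 16)            ≡⟨ *-suc 8 (n / 16) ⟩
  -- As `16 ≤ n`, the quotient is at least 1, so adding 1 at most doubles it.
  8 + 8 * (n / 16)            ≤⟨ +-monoˡ-≤ (8 * (n / 16)) (*-monoʳ-≤ 8 (/-monoˡ-≤ 16 16≤n)) ⟩
  8 * (n / 16) + 8 * (n / 16) ≡⟨ double (n / 16) ⟩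
  n / 16 * 16                 ≤⟨ m/n*n≤m n 16 ⟩
  n                           ∎
  where
  open ≤-Reasoning
  double : ∀ y → 8 * y + 8 * y ≡ y * 16
  double = solve-∀

-- The step-up needs `2 ^ s ≤ l`, which holds as `s = 8 * n ≤ x`, and `t < l`, which holds as `t` is
-- at most cubic in `x` and `2 ^ x ≤ l`.
avoidsBound : ∀ n u {m l} .{{_ : NonZero n}} .{{_ : NonZero u}} → let x = ⌊log₂ l ⌋ in
              0 < l → 16 ≤ x → 8 * n ≤ x → 2 ^ u ≤ x → m < 2 ^ (n * u) → Avoids (2 ^ m) l
avoidsBound n u {m} {l} l>0 16≤x 8n≤x 2^u≤x m< =
  let g , red , blue = ramseyGraph k m s t (trueBound m<) (falseBound m<)
  in avoids g red blue 2^s≤l t<l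
  where
  open ≤-Reasoning
  open Parameters n u
  x = ⌊log₂ l ⌋
  2^s≤l : 2 ^ s ≤ l
  2^s≤l = ≤-trans (^-monoʳ-≤ 2 (≤-trans (≤-reflexive (sym (*-distribʳ-+ n 4 4))) 8n≤x)) (2^⌊log₂⌋≤ l l>0)
  double : ∀ n u k → 4 * n * u * k + 4 * n * u * k ≡ 8 * n * u * k
  double = solve-∀
  t<l : suc t ≤ l
  t<l = begin-strict
    t                           ≡⟨ double n u (2 ^ u) ⟩
    -- The three factors `8 * n`, `u < 2 ^ u` and `2 ^ u` are each at most `x`.
    8 * n * u * 2 ^ u           ≤⟨ *-mono-≤ (*-mono-≤ 8n≤x (≤-trans (<⇒≤ (n<2^n u)) 2^u≤x)) 2^u≤x ⟩
    x * x * x                   <⟨ n³<2^n (≤⇒≤′ 16≤x) ⟩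
    2 ^ x                       ≤⟨ 2^⌊log₂⌋≤ l l>0 ⟩
    l                           ∎

theorem1 : Σ ℕ λ q → Σ ℕ λ L → ∀ (l : ℕ) → L ≤ l →
    ∀ (m : ℕ) → m ^ suc q < l ^ ⌊log₂ ⌊log₂ l ⌋ ⌋ → Avoids (2 ^ m) l
-- `suc q = 16` amounts to `c = 1/16`, and `2 ^ 16 ≤ l` makes the logarithm of `l` at least 16.
theorem1 = 15 , 2 ^ 16 , λ l 2^16≤l m m^16< → bound l (0<l l 16 2^16≤l) (≤⌊log₂⌋ {16} {l} 2^16≤l) m m^16<
  where
  0<l : ∀ l k → 2 ^ k ≤ l → 0 < l
  0<l l k = ≤-trans (m^n>0 2 k)
  bound : ∀ l → 0 < l → 16 ≤ ⌊log₂ l ⌋ → ∀ m → m ^ 16 < l ^ ⌊log₂ ⌊log₂ l ⌋ ⌋ → Avoids (2 ^ m) l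
  bound l l>0 16≤x m m^16< =
    -- `suc (x / 16)` is the least `n` with `x < n * 16`; 16 is twice the 8 in `8 * n ≤ x` to allow
    -- for rounding up.
    avoidsBound (suc (x / 16)) u {{_}} {{>-nonZero u>0}} l>0 16≤x (8*[1+n/16]≤n x 16≤x)
      (2^⌊log₂⌋≤ x (≤-trans (m≤m+n 1 15) 16≤x))
      (<2^-exponent 16 (suc (x / 16)) {m} {l} u (n<[1+n/16]*16 x) m^16<)
    where
    x u : ℕ
    x = ⌊log₂ l ⌋
    u = ⌊log₂ x ⌋
    u>0 : 0 < u
    u>0 = ≤⌊log₂⌋ {1} {x} (≤-trans (m≤m+n 2 14) 16≤x)
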